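{- For every integer $N\ge16$, \[ h(N)\le \lfloor\sqrt{N}\rfloor+\big\lfloor\sqrt{\lfloor\sqrt{N}\rfloor}\big\rfloor+2. \]
   Context: A finite set $A\subseteq\mathbb{Z}$ is Sidon if $a+b=c+d$ with $a,b,c,d\in A$ implies $\{a,b\}=\{c,d\}$ as unordered pairs. For a natural number $N$, $h(N)=\max\{|A| : A\subseteq\{1,\dots,N\},\ A\text{ Sidon}\}$. -}

module Defs where

open import Level using (0ℓ)
open import Data.Empty using (⊥-elim)
open import Data.Fin using (Fin; toℕ)
open import Data.Fin.Properties using (all?)
open import Data.Fin.Subset using (Subset; _∈_; ∣_∣; ⊥)
open import Data.Fin.Subset.Properties using (_∈?_; anySubset?; ∣p∣≤n; ∣⊥∣≡0; ∉⊥)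
open import Data.Integer using (ℤ; +_) renaming (_+_ to _+ℤ_)
import Data.Integer.Properties as ℤ
open import Data.Nat using (ℕ; zero; suc; _*_; _≤_; z≤n)
import Data.Nat.Properties as ℕ
open import Data.Product using (∃; ∃-syntax; _×_; _,_; proj₁)
open import Data.Sum using (_⊎_)
open import Relation.Nullary using (Dec; yes; no; map′; _×-dec_; _⊎-dec_; _→-dec_)
open import Relation.Unary using (Pred; Decidable)
open import Relation.Binary.PropositionalEquality using (_≡_; refl; subst)

IsGreatest : Pred ℕ 0ℓ → ℕ → Set
IsGreatest P m = P m × (∀ n → P n → n ≤ m)

greatest : {P : Pred ℕ 0ℓ} → Decidable P → P 0 →
           ∀ b → (∀ n → P n → n ≤ b) → ∃ (IsGreatest P)
greatest         P? p₀ zero    bound = 0 , p₀ , bound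
greatest {P = P} P? p₀ (suc b) bound with P? (suc b)
... | yes p = suc b , p , bound
... | no ¬p = greatest P? p₀ b λ n pn →
  ℕ.≤-pred (ℕ.≤∧≢⇒< (bound n pn) λ n≡ → ¬p (subst P n≡ pn))

⌊√⌋-exists : ∀ n → ∃ (IsGreatest λ s → s * s ≤ n)
⌊√⌋-exists n = greatest (λ s → s * s ℕ.≤? n) z≤n n λ s → ℕ.≤-trans (s≤s*s s)
  where
  s≤s*s : ∀ s → s ≤ s * s
  s≤s*s zero    = z≤n
  s≤s*s (suc s) = ℕ.m≤m*n (suc s) (suc s)

⌊√_⌋ : ℕ → ℕ
⌊√ n ⌋ = proj₁ (⌊√⌋-exists n)

-- The two disjuncts spell out {a , b} = {c , d} as unordered pairs.
Sidon : Pred ℤ 0ℓ → Set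
Sidon A = ∀ a b c d → A a → A b → A c → A d → a +ℤ b ≡ c +ℤ d →
          (a ≡ c × b ≡ d) ⊎ (a ≡ d × b ≡ c)

-- `Subset N` consists of the subsets of {0,…,N-1}; an index i stands for
-- the integer i + 1, so these represent exactly the subsets of {1,…,N}.
element : ∀ {N} → Fin N → ℤ
element i = + suc (toℕ i)

⟦_⟧ : ∀ {N} → Subset N → Pred ℤ 0ℓ
⟦ A ⟧ z = ∃[ i ] i ∈ A × z ≡ element i

sidon? : ∀ {N} (A : Subset N) → Dec (Sidon ⟦ A ⟧)
sidon? A = map′
  (λ f → λ { _ _ _ _ (i , i∈ , refl) (j , j∈ , refl) (k , k∈ , refl) (l , l∈ , refl) →
             f i j k l i∈ j∈ k∈ l∈ })
  (λ f i j k l i∈ j∈ k∈ l∈ →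
     f _ _ _ _ (i , i∈ , refl) (j , j∈ , refl) (k , k∈ , refl) (l , l∈ , refl))
  (all? λ i → all? λ j → all? λ k → all? λ l →
    (i ∈? A) →-dec (j ∈? A) →-dec (k ∈? A) →-dec (l ∈? A) →-dec
    (element i +ℤ element j ℤ.≟ element k +ℤ element l) →-dec
    (((element i ℤ.≟ element k) ×-dec (element j ℤ.≟ element l)) ⊎-dec
     ((element i ℤ.≟ element l) ×-dec (element j ℤ.≟ element k))))

SidonSize : ℕ → Pred ℕ 0ℓ
SidonSize N m = ∃ λ (A : Subset N) → Sidon ⟦ A ⟧ × ∣ A ∣ ≡ m

h-exists : ∀ N → ∃ (IsGreatest (SidonSize N))
h-exists N = greatest
  (λ m → anySubset? λ A → sidon? A ×-dec (∣ A ∣ ℕ.≟ m))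
  (⊥ , (λ { _ _ _ _ (_ , i∈⊥ , _) → ⊥-elim (∉⊥ i∈⊥) }) , ∣⊥∣≡0 N)
  N
  λ { _ (A , _ , ∣A∣≡m) → subst (_≤ N) ∣A∣≡m (∣p∣≤n A) }

h : ℕ → ℕ
h N = proj₁ (h-exists N)

{-# OPTIONS --safe #-}

-- Lindström's argument. Let a₁ < … < aₘ be a Sidon set in {1,…,N} and consider
-- the differences aⱼ − aᵢ with 1 ≤ j − i ≤ ν. They are K ≥ νm − ν(ν+1)/2
-- distinct positive integers, so their sum is at least K(K+1)/2. On the other
-- hand the differences with j − i = k split into k telescoping chains, so the
-- sum is at most Nν(ν+1)/2. The choice ν = ⌊√⌊√N⌋⌋ + 1 gives the bound.
module Submission where

open import Data.Nat using (ℕ; _+_; _≤_)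
open import Defs

open import Data.Nat using (zero; suc; _*_; _∸_; _<_; z≤n; z<s)
open import Data.Nat.ListAction using (sum)
open import Data.Nat.ListAction.Properties using (sum-++; sum-↭)
open import Data.Nat.Properties
open import Data.Nat.Tactic.RingSolver using (solve-∀)
open import Data.Bool using (true; false)
open import Data.Fin using (zero; suc; toℕ)
open import Data.Fin.Properties using (toℕ<n)
open import Data.Fin.Subset using (Subset; ∣_∣) renaming (_∈_ to _∈ₛ_)
open import Data.Integer using () renaming (+_ to pos)
import Data.Integer.Properties as ℤ
open import Data.List using (List; []; _∷_; _++_; map; take; length)
open import Data.List.Properties using (length-++; length-map; length-take)
open import Data.List.Membership.Propositional using (_∈_)
open import Data.List.Relation.Binary.Permutation.Propositional using (↭-sym; ↭⇒↭ₛ)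
open import Data.List.Relation.Binary.Permutation.Propositional.Properties
  using (↭-length; All-resp-↭)
import Data.List.Relation.Binary.Permutation.Setoid.Properties as Permutation
open import Data.List.Relation.Unary.All as All using (All; []; _∷_)
import Data.List.Relation.Unary.All.Properties as All
open import Data.List.Relation.Unary.AllPairs as AllPairs using (AllPairs; []; _∷_)
import Data.List.Relation.Unary.AllPairs.Properties as AllPairs
open import Data.List.Relation.Unary.Any using (here; there)
open import Data.List.Relation.Unary.Sorted.TotalOrder.Properties using (Sorted⇒AllPairs)
open import Data.List.Relation.Unary.Unique.Propositional using (Unique)
open import Data.List.Relation.Unary.Unique.Propositional.Properties using (++⁺)
open import Data.List.Sort ≤-decTotalOrder using (sort; sort-↭; sort-↗)
open import Data.Product using (∃-syntax; ∃₂; _×_; _,_; proj₁; proj₂)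
open import Data.Sum using (_⊎_; inj₁; inj₂)
open import Data.Vec using ([]; _∷_; here; there)
open import Function using (const)
open import Relation.Binary.PropositionalEquality
open import Relation.Nullary using (¬_; contradiction)

-- Sums of distinct positive integers

-- The entries are at least k + 1, k + 2, ..., and doubling avoids the division in the arithmetic
-- series. The lower bound `k` varies because the tail is bounded below by `suc k`.
strictlySorted-sum : ∀ k {xs} → All (k <_) xs → AllPairs _<_ xs →
                     length xs * (2 * k + suc (length xs)) ≤ 2 * sum xs
strictlySorted-sum k {[]}     []          []         = ≤-refl
strictlySorted-sum k {x ∷ xs} (k<x ∷ _) (x<xs ∷ xs↑) = begin
  suc n * (2 * k + suc (suc n))            ≡⟨ split n k ⟩
  2 * suc k + n * (2 * suc k + suc n)      ≤⟨ +-monoʳ-≤ (2 * suc k) ih ⟩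
  2 * suc k + 2 * sum xs                   ≤⟨ +-monoˡ-≤ (2 * sum xs) (*-monoʳ-≤ 2 k<x) ⟩
  2 * x + 2 * sum xs                       ≡⟨ *-distribˡ-+ 2 x (sum xs) ⟨
  2 * (x + sum xs)                         ∎
  where
  open ≤-Reasoning
  n = length xs
  ih = strictlySorted-sum (suc k) (All.map (≤-<-trans k<x) x<xs) xs↑
  split : ∀ n k → suc n * (2 * k + suc (suc n)) ≡ 2 * suc k + n * (2 * suc k + suc n)
  split = solve-∀

-- Sorting makes distinct entries strictly increasing and preserves length and sum.
unique-sum : ∀ {xs} → All (0 <_) xs → Unique xs →
             length xs * suc (length xs) ≤ 2 * sum xs
unique-sum {xs} xs>0 xs! =
  subst₂ (λ n s → n * suc n ≤ 2 * s) (↭-length (sort-↭ xs)) (sum-↭ (sort-↭ xs))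
    (strictlySorted-sum 0 (All-resp-↭ (↭-sym (sort-↭ xs)) xs>0) sort↑)
  where
  sort! : Unique (sort xs)
  sort! = Permutation.Unique-resp-↭ (setoid ℕ) (↭⇒↭ₛ (↭-sym (sort-↭ xs))) xs!

  sort↑ : AllPairs _<_ (sort xs)
  sort↑ = AllPairs.zipWith (λ (x≤y , x≢y) → ≤∧≢⇒< x≤y x≢y)
    (Sorted⇒AllPairs ≤-totalOrder (sort-↗ xs) , sort!)

-- Differences of order at most ν

differences : ℕ → List ℕ → List ℕ
differences ν []       = []
differences ν (x ∷ xs) = map (_∸ x) (take ν xs) ++ differences ν xs

-- The additive form `x + d ≡ y` avoids truncated subtraction and feeds directly into the Sidon
-- condition.
IsDifference : List ℕ → ℕ → Set
IsDifference xs d = ∃₂ λ x y → x ∈ xs × y ∈ xs × x < y × x + d ≡ y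

SidonList : List ℕ → Set
SidonList xs = ∀ {a b c d} → a ∈ xs → b ∈ xs → c ∈ xs → d ∈ xs →
               a + b ≡ c + d → (a ≡ c × b ≡ d) ⊎ (a ≡ d × b ≡ c)

headDifferences : ∀ ν {x xs} → All (x <_) xs →
                  All (λ d → ∃[ y ] y ∈ xs × x < y × x + d ≡ y) (map (_∸ x) (take ν xs))
headDifferences ν x<xs = All.map⁺ (All.take⁺ ν (All.tabulate λ y∈xs →
  let x<y = All.lookup x<xs y∈xs in _ , y∈xs , x<y , m+[n∸m]≡n (<⇒≤ x<y)))

differences-all : ∀ ν {xs} → AllPairs _<_ xs → All (IsDifference xs) (differences ν xs)
differences-all ν []            = []
differences-all ν (x<xs ∷ xs↑) = All.++⁺
  (All.map (λ (y , y∈ , x<y , eq) → _ , y , here refl , there y∈ , x<y , eq)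
    (headDifferences ν x<xs))
  (All.map (λ (x′ , y , x′∈ , y∈ , x′<y , eq) → x′ , y , there x′∈ , there y∈ , x′<y , eq)
    (differences-all ν xs↑))

IsDifference⇒positive : ∀ {xs d} → IsDifference xs d → 0 < d
IsDifference⇒positive {d = zero}  (x , _ , _ , _ , x<y , refl) =
  contradiction (sym (+-identityʳ x)) (<⇒≢ x<y)
IsDifference⇒positive {d = suc _} _ = z<s

map-∸-strictlySorted : ∀ {x ys} → All (x ≤_) ys → AllPairs _<_ ys →
                       AllPairs _<_ (map (_∸ x) ys)
map-∸-strictlySorted []           []           = []
map-∸-strictlySorted (x≤y ∷ x≤ys) (y<ys ∷ ys↑) =
  All.map⁺ (All.map (λ y<z → ∸-monoˡ-< y<z x≤y) y<ys) ∷ map-∸-strictlySorted x≤ys ys↑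

-- Differences from the head are distinct because the list increases; the Sidon condition separates
-- them from those within the tail.
differences-unique : ∀ ν {xs} → AllPairs _<_ xs → SidonList xs → Unique (differences ν xs)
differences-unique ν {[]}     []           _     = []
differences-unique ν {x ∷ xs} (x<xs ∷ xs↑) sidon = ++⁺
  (AllPairs.map <⇒≢ (map-∸-strictlySorted (All.take⁺ ν (All.map <⇒≤ x<xs)) (AllPairs.take⁺ ν xs↑)))
  (differences-unique ν xs↑ λ a b c d → sidon (there a) (there b) (there c) (there d))
  λ (d∈head , d∈tail) →
    disjoint (All.lookup (headDifferences ν x<xs) d∈head)
             (All.lookup (differences-all ν xs↑) d∈tail)
  where
  swap : ∀ x d x′ → (x + d) + x′ ≡ x + (x′ + d)
  swap = solve-∀

  disjoint : ∀ {d} → (∃[ y ] y ∈ xs × x < y × x + d ≡ y) → ¬ IsDifference xs d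
  disjoint {d} (_ , y∈ , x<y , refl) (x′ , _ , x′∈ , y′∈ , _ , refl)
    -- y - x = y′ - x′ is read as y + x′ = x + y′. Either matching identifies `x` with an element of
    -- the tail, all of which exceed `x`.
    with sidon (there y∈) (there x′∈) (here refl) (there y′∈) (swap x d x′)
  ... | inj₁ (y≡x , _)  = <⇒≢ x<y (sym y≡x)
  ... | inj₂ (_ , x′≡x) = <⇒≢ (All.lookup x<xs x′∈) (sym x′≡x)

-- Σⱼ (ν − j) f(xⱼ) over the first ν entries x₀, x₁, … of the list. This is the
-- potential that makes the telescoping of `differences` a list induction.
weighted : (ℕ → ℕ) → ℕ → List ℕ → ℕ
weighted f zero    xs       = 0
weighted f (suc ν) []       = 0
weighted f (suc ν) (x ∷ xs) = suc ν * f x + weighted f ν xs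

-- Raising ν by one adds 1 to each coefficient ν - j, the one at j = ν rising from 0. This relates
-- the potential of a tail before and after a new head pushes its entries one place on.
weighted-suc : ∀ f ν xs →
  weighted f (suc ν) xs ≡ sum (map f (take (suc ν) xs)) + weighted f ν xs
weighted-suc f zero    []       = refl
weighted-suc f (suc ν) []       = refl
weighted-suc f zero    (x ∷ xs) = refl
weighted-suc f (suc ν) (x ∷ xs) = begin
  suc (suc ν) * f x + weighted f (suc ν) xs     ≡⟨ cong (_+_ (suc (suc ν) * f x)) (weighted-suc f ν xs) ⟩
  suc (suc ν) * f x + (s + weighted f ν xs)     ≡⟨ regroup ν (f x) s (weighted f ν xs) ⟩
  f x + s + (suc ν * f x + weighted f ν xs)     ∎
  where
  open ≡-Reasoning
  s = sum (map f (take (suc ν) xs))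
  regroup : ∀ ν a s w → suc (suc ν) * a + (s + w) ≡ a + s + (suc ν * a + w)
  regroup = solve-∀

-- The coefficients ν, ..., 1 add up to ν(ν + 1)/2; a short list uses only some of them.
weighted-≤ : ∀ f {c} → (∀ x → f x ≤ c) → ∀ ν xs → 2 * weighted f ν xs ≤ c * (ν * suc ν)
weighted-≤ f     f≤c zero    xs       = z≤n
weighted-≤ f     f≤c (suc ν) []       = z≤n
weighted-≤ f {c} f≤c (suc ν) (x ∷ xs) = begin
  2 * (suc ν * f x + weighted f ν xs)       ≡⟨ *-distribˡ-+ 2 (suc ν * f x) _ ⟩
  2 * (suc ν * f x) + 2 * weighted f ν xs
    ≤⟨ +-mono-≤ (*-monoʳ-≤ 2 (*-monoʳ-≤ (suc ν) (f≤c x))) (weighted-≤ f f≤c ν xs) ⟩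
  2 * (suc ν * c) + c * (ν * suc ν)         ≡⟨ collect ν c ⟩
  c * (suc ν * suc (suc ν))                 ∎
  where
  open ≤-Reasoning
  collect : ∀ ν c → 2 * (suc ν * c) + c * (ν * suc ν) ≡ c * (suc ν * suc (suc ν))
  collect = solve-∀

sum-map-1 : ∀ (xs : List ℕ) → sum (map (const 1) xs) ≡ length xs
sum-map-1 []       = refl
sum-map-1 (x ∷ xs) = cong suc (sum-map-1 xs)

-- A new head contributes `length T` differences and raises the potential by `suc ν` minus
-- `length T`, so the right side grows by exactly `suc ν`. The potential counts the differences
-- missing near the end of the list.
length-differences : ∀ ν xs →
  suc ν * length xs ≤ length (differences (suc ν) xs) + weighted (const 1) (suc ν) xs
length-differences ν []       = ≤-reflexive (*-zeroʳ ν)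
length-differences ν (x ∷ xs) = begin
  suc ν * suc (length xs)                   ≡⟨ *-suc (suc ν) (length xs) ⟩
  suc ν + suc ν * length xs                 ≤⟨ +-monoʳ-≤ (suc ν) (length-differences ν xs) ⟩
  suc ν + (length (differences (suc ν) xs) + weighted (const 1) (suc ν) xs)
    ≡⟨ cong (λ w → suc ν + (length (differences (suc ν) xs) + w)) step ⟩
  suc ν + (length (differences (suc ν) xs) + (length T + w))
    ≡⟨ regroup ν (length (differences (suc ν) xs)) (length T) w ⟩
  length T + length (differences (suc ν) xs) + (suc ν * 1 + w)
    ≡⟨ cong (λ t → t + length (differences (suc ν) xs) + (suc ν * 1 + w)) (length-map (_∸ x) T) ⟨
  length (map (_∸ x) T) + length (differences (suc ν) xs) + (suc ν * 1 + w)
    ≡⟨ cong (_+ (suc ν * 1 + w)) (length-++ (map (_∸ x) T)) ⟨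
  length (differences (suc ν) (x ∷ xs)) + (suc ν * 1 + w) ∎
  where
  open ≤-Reasoning
  T = take (suc ν) xs
  w = weighted (const 1) ν xs
  step : weighted (const 1) (suc ν) xs ≡ length T + w
  step = trans (weighted-suc (const 1) ν xs) (cong (_+ w) (sum-map-1 T))
  regroup : ∀ ν d t w → suc ν + (d + (t + w)) ≡ t + d + (suc ν * 1 + w)
  regroup = solve-∀

-- Termwise (y - x) + (M - y) = M - x, which is one telescoping step; x ≤ y ≤ M keeps the truncated
-- subtractions exact.
sum-map-∸ : ∀ {x M ys} → All (x ≤_) ys → All (_≤ M) ys →
            sum (map (_∸ x) ys) + sum (map (M ∸_) ys) ≡ length ys * (M ∸ x)
sum-map-∸ []                             []           = refl
sum-map-∸ {x} {M} {y ∷ ys} (x≤y ∷ x≤ys) (y≤M ∷ ys≤M) = begin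
  (y ∸ x + s) + (M ∸ y + t)     ≡⟨ regroup (y ∸ x) s (M ∸ y) t ⟩
  (M ∸ y + (y ∸ x)) + (s + t)
    ≡⟨ cong₂ _+_ (trans (sym (+-∸-assoc (M ∸ y) x≤y)) (cong (_∸ x) (m∸n+n≡m y≤M)))
                 (sum-map-∸ x≤ys ys≤M) ⟩
  (M ∸ x) + length ys * (M ∸ x) ∎
  where
  open ≡-Reasoning
  s = sum (map (_∸ x) ys)
  t = sum (map (M ∸_) ys)
  regroup : ∀ a s b t → (a + s) + (b + t) ≡ (b + a) + (s + t)
  regroup = solve-∀

-- By `weighted-suc` the potential of the tail releases M - y for each y in `T`. Joined to the new
-- differences y - x, this gives at most `suc ν` copies of M - x, the term of the new head.
sum-differences : ∀ ν {M xs} → AllPairs _<_ xs → All (_≤ M) xs →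
                  sum (differences (suc ν) xs) ≤ weighted (M ∸_) (suc ν) xs
sum-differences ν                []           []           = ≤-refl
sum-differences ν {M} {x ∷ xs} (x<xs ∷ xs↑) (_ ∷ xs≤M) = begin
  sum (map (_∸ x) T ++ differences (suc ν) xs)
    ≡⟨ sum-++ (map (_∸ x) T) _ ⟩
  sum (map (_∸ x) T) + sum (differences (suc ν) xs)
    ≤⟨ +-monoʳ-≤ (sum (map (_∸ x) T)) (sum-differences ν xs↑ xs≤M) ⟩
  sum (map (_∸ x) T) + weighted (M ∸_) (suc ν) xs
    ≡⟨ cong (sum (map (_∸ x) T) +_) (weighted-suc (M ∸_) ν xs) ⟩
  sum (map (_∸ x) T) + (sum (map (M ∸_) T) + w)
    ≡⟨ +-assoc (sum (map (_∸ x) T)) _ w ⟨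
  sum (map (_∸ x) T) + sum (map (M ∸_) T) + w
    ≡⟨ cong (_+ w) (sum-map-∸ (All.take⁺ (suc ν) (All.map <⇒≤ x<xs)) (All.take⁺ (suc ν) xs≤M)) ⟩
  length T * (M ∸ x) + w
    ≤⟨ +-monoˡ-≤ w (*-monoˡ-≤ (M ∸ x) ∣T∣≤) ⟩
  suc ν * (M ∸ x) + w ∎
  where
  open ≤-Reasoning
  T = take (suc ν) xs
  w = weighted (M ∸_) ν xs
  ∣T∣≤ : length T ≤ suc ν
  ∣T∣≤ = ≤-trans (≤-reflexive (length-take (suc ν) xs)) (m⊓n≤m (suc ν) (length xs))

-- Elements of a subset in increasing order

-- `k` is the integer that the first position stands for; `k = 1` agrees with `element`.
elements : ∀ {n} → ℕ → Subset n → List ℕ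
elements k []          = []
elements k (true  ∷ A) = k ∷ elements (suc k) A
elements k (false ∷ A) = elements (suc k) A

length-elements : ∀ {n} k (A : Subset n) → length (elements k A) ≡ ∣ A ∣
length-elements k []          = refl
length-elements k (true  ∷ A) = cong suc (length-elements (suc k) A)
length-elements k (false ∷ A) = length-elements (suc k) A

elements-∈ : ∀ {n} k (A : Subset n) →
             All (λ x → ∃[ i ] i ∈ₛ A × x ≡ k + toℕ i) (elements k A)
elements-∈′ : ∀ {n b} k (A : Subset n) →
              All (λ x → ∃[ i ] i ∈ₛ (b ∷ A) × x ≡ k + toℕ i) (elements (suc k) A)
elements-∈ k []          = []
elements-∈ k (true  ∷ A) = (zero , here , sym (+-identityʳ k)) ∷ elements-∈′ k A
elements-∈ k (false ∷ A) = elements-∈′ k A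
elements-∈′ k A = All.map (λ (i , i∈A , eq) → suc i , there i∈A , trans eq (sym (+-suc k _)))
                          (elements-∈ (suc k) A)

elements-strictlySorted : ∀ {n} k (A : Subset n) → AllPairs _<_ (elements k A)
elements-strictlySorted k []          = []
elements-strictlySorted k (false ∷ A) = elements-strictlySorted (suc k) A
elements-strictlySorted k (true  ∷ A) =
  All.map (λ { (i , _ , refl) → m≤m+n (suc k) (toℕ i) }) (elements-∈ (suc k) A)
  ∷ elements-strictlySorted (suc k) A

elements-≤ : ∀ {N} (A : Subset N) → All (_≤ N) (elements 1 A)
elements-≤ A = All.map (λ { (i , _ , refl) → toℕ<n i }) (elements-∈ 1 A)

elements-sidon : ∀ {N} (A : Subset N) → Sidon ⟦ A ⟧ → SidonList (elements 1 A)
elements-sidon A sidon a∈ b∈ c∈ d∈ eq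
  -- Integer addition of two `pos` values computes to `pos` of the natural sum, so `cong pos eq` has
  -- the required type.
  with sidon _ _ _ _ (member a∈) (member b∈) (member c∈) (member d∈) (cong pos eq)
  where
  member : ∀ {x} → x ∈ elements 1 A → ⟦ A ⟧ (pos x)
  member x∈ = let i , i∈A , eq = All.lookup (elements-∈ 1 A) x∈ in i , i∈A , cong pos eq
... | inj₁ (p , q) = inj₁ (ℤ.+-injective p , ℤ.+-injective q)
... | inj₂ (p , q) = inj₂ (ℤ.+-injective p , ℤ.+-injective q)

-- Lindström's inequalities and the choice of ν

-- `K` is the number of differences of order at most ν. Both bounds are doubled to clear the
-- denominator of ν(ν + 1)/2.
lindström : ∀ {N} (A : Subset N) → Sidon ⟦ A ⟧ → ∀ r → let ν = suc r in
  ∃[ K ] 2 * (ν * ∣ A ∣) ≤ 2 * K + ν * suc ν × K * suc K ≤ N * (ν * suc ν)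
lindström {N} A sidon r = length ds , many , few
  where
  open ≤-Reasoning
  ν  = suc r
  xs = elements 1 A
  ds = differences ν xs
  xs↑ = elements-strictlySorted 1 A

  many : 2 * (ν * ∣ A ∣) ≤ 2 * length ds + ν * suc ν
  many = begin
    2 * (ν * ∣ A ∣)                                ≡⟨ cong (λ m → 2 * (ν * m)) (length-elements 1 A) ⟨
    2 * (ν * length xs)                            ≤⟨ *-monoʳ-≤ 2 (length-differences r xs) ⟩
    2 * (length ds + weighted (const 1) ν xs)      ≡⟨ *-distribˡ-+ 2 (length ds) _ ⟩
    2 * length ds + 2 * weighted (const 1) ν xs
      ≤⟨ +-monoʳ-≤ (2 * length ds) (weighted-≤ (const 1) (λ _ → ≤-refl) ν xs) ⟩
    2 * length ds + 1 * (ν * suc ν)                ≡⟨ cong (_+_ (2 * length ds)) (*-identityˡ (ν * suc ν)) ⟩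
    2 * length ds + ν * suc ν                      ∎

  few : length ds * suc (length ds) ≤ N * (ν * suc ν)
  few = begin
    length ds * suc (length ds)
      ≤⟨ unique-sum (All.map IsDifference⇒positive (differences-all ν xs↑))
                    (differences-unique ν xs↑ (elements-sidon A sidon)) ⟩
    2 * sum ds                   ≤⟨ *-monoʳ-≤ 2 (sum-differences r xs↑ (elements-≤ A)) ⟩
    2 * weighted (N ∸_) ν xs     ≤⟨ weighted-≤ (N ∸_) (m∸n≤m N) ν xs ⟩
    N * (ν * suc ν)              ∎

-- Here 2K ≥ X = ν(2q + ν + 1), and X² ≥ 4q²ν(ν+1) because ν² ≥ q.
lindström-arithmetic : ∀ {N K q m} r → let ν = suc r in
  N < q * q → q ≤ ν * ν →
  2 * (ν * m) ≤ 2 * K + ν * suc ν → K * suc K ≤ N * (ν * suc ν) → m ≤ q + ν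
lindström-arithmetic {N} {K} {q} {m} r N<q² q≤ν² many few = ≮⇒≥ λ q+ν<m →
  let
    -- `X` is 2ν(q + ν + 1) - ν(ν + 1), the lower bound for 2K that `many` yields once m ≥ q + ν +
    -- 1.
    X≤2K : X ≤ 2 * K
    X≤2K = +-cancelʳ-≤ (ν * suc ν) X (2 * K) (begin
      X + ν * suc ν                ≡⟨ X-eq q ν ⟩
      2 * (ν * suc (q + ν))        ≤⟨ *-monoʳ-≤ 2 (*-monoʳ-≤ ν q+ν<m) ⟩
      2 * (ν * m)                  ≤⟨ many ⟩
      2 * K + ν * suc ν            ∎)
  in <-irrefl refl (begin-strict
    -- The chain returns to its first term, so this one strict step gives the contradiction. It
    -- needs ν(ν + 1) nonzero, which ν = `suc r` makes evident.
    4 * (N * (ν * suc ν))          <⟨ *-monoʳ-< 4 (*-monoˡ-< (ν * suc ν) N<q²) ⟩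
    4 * (q * q * (ν * suc ν))      ≡⟨ expand q ν ⟩
    4 * (q * q * (ν * ν)) + 4 * (q * ν) * q
      -- Trading one factor q for ν² turns 4q²ν into 4qν³, a term of X²; this dictates ν of order
      -- √q.
      ≤⟨ +-monoʳ-≤ (4 * (q * q * (ν * ν))) (*-monoʳ-≤ (4 * (q * ν)) q≤ν²) ⟩
    4 * (q * q * (ν * ν)) + 4 * (q * ν) * (ν * ν)
      ≤⟨ m≤m+n _ _ ⟩
    4 * (q * q * (ν * ν)) + 4 * (q * ν) * (ν * ν) + (4 * (q * (ν * ν)) + ν * ν * (suc ν * suc ν))
      ≡⟨ X² q ν ⟩
    X * X                          ≤⟨ *-mono-≤ X≤2K X≤2K ⟩
    2 * K * (2 * K)                ≡⟨ square K ⟩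
    4 * (K * K)                    ≤⟨ *-monoʳ-≤ 4 (*-monoʳ-≤ K (n≤1+n K)) ⟩
    4 * (K * suc K)                ≤⟨ *-monoʳ-≤ 4 few ⟩
    4 * (N * (ν * suc ν))          ∎)
  where
  open ≤-Reasoning
  ν = suc r
  X = ν * (2 * q + suc ν)
  X-eq : ∀ q ν → ν * (2 * q + suc ν) + ν * suc ν ≡ 2 * (ν * suc (q + ν))
  X-eq = solve-∀
  expand : ∀ q ν → 4 * (q * q * (ν * suc ν)) ≡ 4 * (q * q * (ν * ν)) + 4 * (q * ν) * q
  expand = solve-∀
  X² : ∀ q ν → 4 * (q * q * (ν * ν)) + 4 * (q * ν) * (ν * ν)
                 + (4 * (q * (ν * ν)) + ν * ν * (suc ν * suc ν))
               ≡ ν * (2 * q + suc ν) * (ν * (2 * q + suc ν))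
  X² = solve-∀
  square : ∀ K → 2 * K * (2 * K) ≡ 4 * (K * K)
  square = solve-∀

n<suc⌊√n⌋² : ∀ n → n < suc ⌊√ n ⌋ * suc ⌊√ n ⌋
n<suc⌊√n⌋² n = ≰⇒> λ le → 1+n≰n (proj₂ (proj₂ (⌊√⌋-exists n)) (suc ⌊√ n ⌋) le)

sidon-bound : ∀ {N} (A : Subset N) → Sidon ⟦ A ⟧ → ∣ A ∣ ≤ ⌊√ N ⌋ + ⌊√ ⌊√ N ⌋ ⌋ + 2
sidon-bound {N} A sidon =
  let K , many , few = lindström A sidon r
  -- Here q = `suc s` and ν = `suc r`. The strict bound s < ν² is by definition q ≤ ν², and the two
  -- successors make up the 2 in the bound.
  in ≤-trans (lindström-arithmetic {K = K} r (n<suc⌊√n⌋² N) (n<suc⌊√n⌋² s) many few)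
             (≤-reflexive (shift s r))
  where
  s = ⌊√ N ⌋
  r = ⌊√ s ⌋
  shift : ∀ s r → suc s + suc r ≡ s + r + 2
  shift = solve-∀

mainTheorem9 : ∀ (N : ℕ) → 16 ≤ N → h N ≤ ⌊√ N ⌋ + ⌊√ ⌊√ N ⌋ ⌋ + 2
mainTheorem9 N _ =
  let A , sidon , ∣A∣≡h = proj₁ (proj₂ (h-exists N))
  in subst (_≤ ⌊√ N ⌋ + ⌊√ ⌊√ N ⌋ ⌋ + 2) ∣A∣≡h (sidon-bound A sidon)
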